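{- (i) Every positive integer $N\equiv 1\pmod 8$ can be written as $N=x^2+P$ with $x$ a nonnegative integer and $P$ a practical number. (ii) For every $j\in\{0,2,3,4,5,6,7\}$ there exist infinitely many nonnegative integers $k$ such that $8k+j$ cannot be written as $x^2+P$ with $x$ a nonnegative integer and $P$ a practical number.
   Context: A positive integer $N$ is called a practical number if every integer in $[1,N]$ can be expressed as a sum of distinct positive divisors of $N$. -}

module Defs where

open import Data.List.Relation.Unary.All using (All)
open import Data.List.Relation.Unary.Unique.Propositional using (Unique)
open import Data.Nat.Base using (ℕ; _+_; _^_; _≤_; _<_)
open import Data.Nat.Divisibility.Core using (_∣_)
open import Data.Nat.ListAction using (sum)
open import Data.Product.Base using (_×_; ∃-syntax)
open import Relation.Binary.PropositionalEquality.Core using (_≡_)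

SumOfDistinctDivisors : ℕ → ℕ → Set
SumOfDistinctDivisors N m =
  ∃[ ds ] Unique ds × All (λ d → 0 < d × d ∣ N) ds × m ≡ sum ds

Practical : ℕ → Set
Practical N = 0 < N × (∀ m → 1 ≤ m → m ≤ N → SumOfDistinctDivisors N m)

SquarePlusPractical : ℕ → Set
SquarePlusPractical N = ∃[ x ] ∃[ P ] Practical P × N ≡ x ^ 2 + P

-- A set of naturals is infinite exactly when it is unbounded; this is the
-- constructive form, giving an element above any prescribed bound.
InfinitelyMany : (ℕ → Set) → Set
InfinitelyMany Q = ∀ b → ∃[ k ] b ≤ k × Q k

{-# OPTIONS --safe #-}
-- (i) An odd square root of N modulo 2^k can be lifted step by step, and
-- replacing x by 2^(k-1) - x keeps it below 2^(k-2).  Taking k with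
-- 4^(k-2) ≤ N < 4^(k-1) gives N - x² = 2^k m with 0 < m < 2^(k-2), and
-- such a number is practical: write t ≤ 2^k m as q m + r with r < m and
-- expand q and r in binary.
--
-- (ii) If P ≥ 16 is divisible by none of 3, 5, 7, 11, 13, 16, then its divisors
-- up to 16 lie in {1, 2, 4, 8}, whose sum is 15, so 16 is not a sum of distinct
-- divisors of P.  Hence N is not a square plus a practical number once N is a
-- quadratic non-residue modulo 3, 5, 7, 11, 13, 16, and N - 1, N - 2, N - 4,
-- N - 8 are non-residues for suitable moduli; this is a condition modulo
-- 240240 = 16·3·5·7·11·13.
module Submission where

open import Defs
open import Data.Fin.Base using (Fin; toℕ; fromℕ<)
open import Data.Fin.Properties using (all?; toℕ-fromℕ<)
open import Data.List.Base using (List; _∷_; []; _++_; map)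
open import Data.List.Membership.Propositional using (_∈_)
open import Data.List.Membership.DecPropositional using (_∈?_)
open import Data.List.Membership.Propositional.Properties using (∈-∃++; ∈-map⁻)
open import Data.List.Relation.Binary.Permutation.Propositional.Properties
  using (∈-resp-↭; shift)
open import Data.List.Relation.Binary.Subset.Propositional using (_⊆_)
open import Data.List.Relation.Unary.All as All using (All; []; _∷_)
import Data.List.Relation.Unary.All.Properties as All
open import Data.List.Relation.Unary.AllPairs using ([]; _∷_)
open import Data.List.Relation.Unary.Any as Any using (Any; here; there; any?)
open import Data.List.Relation.Unary.Unique.Propositional using (Unique)
import Data.List.Relation.Unary.Unique.Propositional.Properties as Unique
open import Data.Nat.Base
open import Data.Nat.Coprimality using (Coprime; coprime-divisor)
open import Data.Nat.Divisibility
open import Data.Nat.DivMod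
open import Data.Nat.ListAction using (sum)
open import Data.Nat.ListAction.Properties using (sum-++; sum-↭)
open import Data.Nat.Properties
open import Data.Nat.Tactic.RingSolver using (solve-∀)
open import Data.Product.Base using (_×_; _,_; proj₂; ∃-syntax)
open import Data.Sum.Base using (_⊎_; inj₁; inj₂)
open import Function.Base using (_$_)
open import Relation.Binary.PropositionalEquality
open import Relation.Nullary using (¬_; Dec; yes; no; contradiction)
open import Relation.Nullary.Decidable using (True; from-yes; toWitness; ¬?; _⊎-dec_; _×-dec_; _→-dec_)

-- Parity and sums of lists

halve : ∀ n → ∃[ h ] (n ≡ 2 * h ⊎ n ≡ 1 + 2 * h)
halve zero = 0 , inj₁ refl
halve (suc n) with halve n
... | h , inj₁ refl = h , inj₂ refl
... | h , inj₂ refl = suc h , inj₁ (sym (*-suc 2 h))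

sum-map-* : ∀ c ns → sum (map (c *_) ns) ≡ c * sum ns
sum-map-* c []       = sym (*-zeroʳ c)
sum-map-* c (n ∷ ns) =
  trans (cong (c * n +_) (sum-map-* c ns)) (sym (*-distribˡ-+ c n (sum ns)))

∈⇒≤sum : ∀ {n ns} → n ∈ ns → n ≤ sum ns
∈⇒≤sum (here refl)              = m≤m+n _ _
∈⇒≤sum (there {x = m} n∈ns) = ≤-trans (∈⇒≤sum n∈ns) (m≤n+m _ m)

-- Induction on `ms`: the head is deleted from `ns`, and by uniqueness the tail still lies in what
-- remains.
sum-mono-⊆ : ∀ {ms ns} → Unique ms → ms ⊆ ns → sum ms ≤ sum ns
sum-mono-⊆ [] _ = z≤n
sum-mono-⊆ {m ∷ ms} (m∉ms ∷ ums) ms⊆ns with ∈-∃++ (ms⊆ns (here refl))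
... | as , bs , refl = begin
  m + sum ms          ≤⟨ +-monoʳ-≤ m (sum-mono-⊆ ums ms⊆as++bs) ⟩
  m + sum (as ++ bs)  ≡⟨ sum-↭ (shift m as bs) ⟨
  sum (as ++ m ∷ bs)  ∎
  where
  open ≤-Reasoning
  ms⊆as++bs : ms ⊆ as ++ bs
  ms⊆as++bs x∈ms with ∈-resp-↭ (shift m as bs) (ms⊆ns (there x∈ms))
  ... | here refl = contradiction refl (All.lookup m∉ms x∈ms)
  ... | there x∈  = x∈

-- Practical numbers of the form 2^k m

oddNotTwice : ∀ a b → 1 + 2 * a ≢ 2 * b
oddNotTwice a b eq = even≢odd b a (sym eq)

odd-coprime-2 : ∀ a → Coprime (1 + 2 * a) 2
odd-coprime-2 a {0}             (0∣m , _) with () ← 0∣⇒≡0 0∣m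
odd-coprime-2 a {1}             _         = refl
odd-coprime-2 a {2}             (divides b eq , _) =
  contradiction (trans eq (*-comm b 2)) (oddNotTwice a b)
odd-coprime-2 a {suc (suc (suc _))} (_ , d∣2) with s≤s (s≤s ()) ← ∣⇒≤ d∣2

odd∣2^⇒≡1 : ∀ a k → 1 + 2 * a ∣ 2 ^ k → 1 + 2 * a ≡ 1
odd∣2^⇒≡1 a zero    m∣1 = ∣1⇒≡1 m∣1
odd∣2^⇒≡1 a (suc k) m∣2^ = odd∣2^⇒≡1 a k (coprime-divisor (odd-coprime-2 a) m∣2^)

sumOfDivisors-zero : ∀ {n} → SumOfDistinctDivisors n 0
sumOfDivisors-zero = [] , [] , [] , refl

sumOfDivisors-2* : ∀ {n h} → SumOfDistinctDivisors n h →
                   SumOfDistinctDivisors (2 * n) (2 * h)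
sumOfDivisors-2* (ds , uds , dds , refl) =
  map (2 *_) ds ,
  Unique.map⁺ (*-cancelˡ-≡ _ _ 2) uds ,
  All.map⁺ (All.map (λ (0<d , d∣n) → *-monoʳ-< 2 0<d , *-monoʳ-∣ 2 d∣n) dds) ,
  sym (sum-map-* 2 ds)

-- The doubled divisors are all even, so the divisor 1 can be added without repetition.
sumOfDivisors-1+2* : ∀ {n h} → SumOfDistinctDivisors n h →
                     SumOfDistinctDivisors (2 * n) (1 + 2 * h)
sumOfDivisors-1+2* {n} (ds , uds , dds , refl) =
  let _ , u2ds , d2ds , eq = sumOfDivisors-2* {n} (ds , uds , dds , refl) in
  1 ∷ map (2 *_) ds ,
  All.map⁺ (All.universal (oddNotTwice 0) ds) ∷ u2ds ,
  (z<s , 1∣ _) ∷ d2ds ,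
  cong suc eq

practical-2* : ∀ {n} → Practical n → Practical (2 * n)
practical-2* {n} (0<n , sums) = *-monoʳ-< 2 0<n , λ m _ → go m
  where
  sums₀ : ∀ m → m ≤ n → SumOfDistinctDivisors n m
  sums₀ zero    _ = sumOfDivisors-zero
  sums₀ (suc m)   = sums (suc m) (s≤s z≤n)
  go : ∀ m → m ≤ 2 * n → SumOfDistinctDivisors (2 * n) m
  go m m≤2n with halve m
  ... | h , inj₁ refl = sumOfDivisors-2* (sums₀ h (*-cancelˡ-≤ 2 m≤2n))
  ... | h , inj₂ refl =
    sumOfDivisors-1+2* (sums₀ h (*-cancelˡ-≤ 2 (≤-trans (n≤1+n _) m≤2n)))

-- Binary expansion, one digit per halving. The bound is sharp, since all divisors of `2 ^ k` add up
-- to `2 ^ suc k` minus 1.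
sumOfDivisors-2^ : ∀ k m → m < 2 ^ suc k → SumOfDistinctDivisors (2 ^ k) m
sumOfDivisors-2^ zero 0 _ = sumOfDivisors-zero
sumOfDivisors-2^ zero 1 _ = 1 ∷ [] , [] ∷ [] , (z<s , 1∣ 1) ∷ [] , refl
sumOfDivisors-2^ zero (suc (suc m)) (s≤s (s≤s ()))
sumOfDivisors-2^ (suc k) m m<2^ with halve m
... | h , inj₁ refl = sumOfDivisors-2* (sumOfDivisors-2^ k h (*-cancelˡ-< 2 _ _ m<2^))
... | h , inj₂ refl =
  sumOfDivisors-1+2* (sumOfDivisors-2^ k h (*-cancelˡ-< 2 _ _ (m+n≤o⇒n≤o 1 m<2^)))

module _ (k a : ℕ) (m≢1 : 1 + 2 * a ≢ 1) where
  private m = 1 + 2 * a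

  -- An odd `m` other than 1 divides no power of two, so no multiple `m * d` can coincide with a
  -- divisor used for `r`.
  sumOfDivisors-2^*odd : ∀ {q r} →
    SumOfDistinctDivisors (2 ^ k) q → SumOfDistinctDivisors (2 ^ k) r →
    SumOfDistinctDivisors (2 ^ k * m) (m * q + r)
  sumOfDivisors-2^*odd (as , uas , das , refl) (bs , ubs , dbs , refl) =
    map (m *_) as ++ bs ,
    Unique.++⁺ (Unique.map⁺ (*-cancelˡ-≡ _ _ m) uas) ubs disjoint ,
    All.++⁺
      (All.map⁺ (All.map (λ {d} (0<d , d∣) →
         *-mono-< (z<s {2 * a}) 0<d , subst (m * d ∣_) (*-comm m (2 ^ k)) (*-monoʳ-∣ m d∣)) das))
      (All.map (λ (0<d , d∣) → 0<d , ∣m⇒∣m*n m d∣) dbs) ,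
    sym (trans (sum-++ (map (m *_) as) bs) (cong (_+ sum bs) (sum-map-* m as)))
    where
    disjoint : ∀ {v} → ¬ (v ∈ map (m *_) as × v ∈ bs)
    disjoint (v∈as , v∈bs) with d , _ , refl ← ∈-map⁻ (m *_) v∈as =
      m≢1 (odd∣2^⇒≡1 a k (m*n∣⇒m∣ m d (proj₂ (All.lookup dbs v∈bs))))

  practical-2^*odd : m ≤ 2 ^ suc k → Practical (2 ^ k * m)
  -- Division of `t` by `m`: the quotient is at most `2 ^ k` and the remainder is below `m`, so both
  -- are below `2 ^ suc k`.
  practical-2^*odd m≤ = *-mono-< (m^n>0 2 k) (z<s {2 * a}) , λ t _ t≤ →
    subst (SumOfDistinctDivisors _)
      (trans (+-comm (m * (t / m)) _)
        (trans (cong (t % m +_) (*-comm m (t / m))) (sym (m≡m%n+[m/n]*n t m)))) $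
    sumOfDivisors-2^*odd
      (sumOfDivisors-2^ k (t / m) (≤-<-trans (quotient≤ t t≤) 2^k<))
      (sumOfDivisors-2^ k (t % m) (<-≤-trans (m%n<n t m) m≤))
    where
    2^k< : 2 ^ k < 2 ^ suc k
    2^k< = ^-monoʳ-< 2 (s≤s (s≤s z≤n)) (n<1+n k)
    quotient≤ : ∀ t → t ≤ 2 ^ k * m → t / m ≤ 2 ^ k
    quotient≤ t t≤ = subst (t / m ≤_) (m*n/n≡m (2 ^ k) m) (/-monoˡ-≤ m t≤)

practical-2^ : ∀ k → Practical (2 ^ k)
practical-2^ k = m^n>0 2 k , λ m _ m≤ →
  sumOfDivisors-2^ k m (≤-<-trans m≤ (^-monoʳ-< 2 (s≤s (s≤s z≤n)) (n<1+n k)))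

-- Factors 2 of `m` are stripped off and restored by `practical-2*`. Each one lowers `e` while `k`
-- stays fixed, so the odd part still meets the bound of `practical-2^*odd`.
practical-2^* : ∀ e k m → e ≤ suc k → 0 < m → m ≤ 2 ^ e → Practical (2 ^ k * m)
practical-2^* e k m e≤ 0<m m≤ with halve m
practical-2^* e k m e≤ 0<m m≤ | a , inj₂ refl with 1 + 2 * a ≟ 1
... | yes eq = subst Practical (sym (trans (cong (2 ^ k *_) eq) (*-identityʳ _))) (practical-2^ k)
... | no m≢1 = practical-2^*odd k a m≢1 (≤-trans m≤ (^-monoʳ-≤ 2 e≤))
practical-2^* e k m e≤ () m≤ | zero , inj₁ refl
practical-2^* zero k m e≤ 0<m m≤ | suc h , inj₁ refl =
  contradiction (subst (_≤ 1) (*-suc 2 h) m≤) λ { (s≤s ()) }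
practical-2^* (suc e) k m e≤ 0<m m≤ | suc h , inj₁ refl =
  subst Practical (swap (2 ^ k) (suc h)) $ practical-2* $
  practical-2^* e k (suc h) (≤-trans (n≤1+n e) e≤) z<s (*-cancelˡ-≤ 2 m≤)
  where
  swap : ∀ x y → 2 * (x * y) ≡ x * (2 * y)
  swap = solve-∀

-- Small square roots modulo powers of two

1+2u<2D : ∀ {u D} → u < D → 1 + 2 * u < 2 * D
1+2u<2D {u} {D} u<D = subst (_≤ 2 * D) (*-suc 2 u) (*-monoʳ-≤ 2 u<D)

-- With S = 1 + u + v, the roots 1 + 2u and 1 + 2v sum to 2S; both sides of
-- the identity are moved so that no subtraction occurs.
flipIdentity : ∀ u v h → let S = 1 + u + v in
  (1 + 2 * v) * (1 + 2 * v) + 8 * S * (1 + u + h)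
    ≡ (1 + 2 * u) * (1 + 2 * u) + 4 * S * (1 + 2 * h) + 4 * S * S
flipIdentity = solve-∀

-- The root `x = 1 + 2 * u` is replaced by `y = 4 * D - x`. This turns an odd cofactor of `8 * D`
-- into a multiple of `16 * D`; the lower bound on `N` gives `y² ≤ N`, so the new cofactor is not
-- negative.
flipRoot : ∀ {N} D .{{_ : NonZero D}} u v h → 1 + u + v ≡ 2 * D →
  2 * (2 * D) * (2 * (2 * D)) ≤ N →
  N ≡ (1 + 2 * u) * (1 + 2 * u) + 4 * (2 * D) * (1 + 2 * h) →
  ∃[ m ] N ≡ (1 + 2 * v) * (1 + 2 * v) + 4 * (2 * (2 * D)) * m
flipRoot {N} D u v h S≡2D bound N≡ = m , sym N≡′
  where
  S = 2 * D
  y² = (1 + 2 * v) * (1 + 2 * v)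

  y≤2S : 1 + 2 * v ≤ 2 * S
  y≤2S = <⇒≤ (1+2u<2D (subst (v <_) S≡2D (s≤s (m≤n+m v u))))

  y²≤N : y² ≤ N
  y²≤N = ≤-trans (*-mono-≤ y≤2S y≤2S) bound

  flipped : y² + 8 * S * (1 + u + h) ≡ N + 4 * S * S
  flipped = trans
    (subst (λ S → y² + 8 * S * (1 + u + h) ≡
                  (1 + 2 * u) * (1 + 2 * u) + 4 * S * (1 + 2 * h) + 4 * S * S)
      S≡2D (flipIdentity u v h))
    (cong (_+ 4 * S * S) (sym N≡))

  8SD≡4SS : ∀ D → 8 * (2 * D) * D ≡ 4 * (2 * D) * (2 * D)
  8SD≡4SS = solve-∀

  -- This makes the truncated subtraction in `m` exact.
  D≤ : D ≤ 1 + u + h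
  D≤ = *-cancelˡ-≤ (8 * S) {{m*n≢0 8 S {{_}} {{m*n≢0 2 D}}}} $ +-cancelˡ-≤ y² _ _ $ begin
    y² + 8 * S * D            ≤⟨ +-monoˡ-≤ _ y²≤N ⟩
    N + 8 * S * D             ≡⟨ cong (N +_) (8SD≡4SS D) ⟩
    N + 4 * S * S             ≡⟨ flipped ⟨
    y² + 8 * S * (1 + u + h)  ∎
    where open ≤-Reasoning

  m = 1 + u + h ∸ D

  regroup : ∀ x D m → x + 4 * (2 * (2 * D)) * m + 4 * (2 * D) * (2 * D)
                    ≡ x + 8 * (2 * D) * (D + m)
  regroup = solve-∀

  N≡′ : y² + 4 * (2 * S) * m ≡ N
  N≡′ = +-cancelʳ-≡ (4 * S * S) _ _ $ trans (regroup y² D m) $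
    trans (cong (λ z → y² + 8 * S * z) (m+[n∸m]≡n D≤)) flipped

-- Induction on `j`, starting from the root 1 modulo 8. If the cofactor `m` is even, the same root
-- works for the doubled modulus; if it is odd, `flipRoot` supplies another one.
smallRoot : ∀ N → N % 8 ≡ 1 → ∀ j → 2 ^ suc j * 2 ^ suc j ≤ N →
  ∃[ u ] ∃[ m ] u < 2 ^ j × N ≡ (1 + 2 * u) * (1 + 2 * u) + 4 * 2 ^ suc j * m
smallRoot N N%8 zero _ =
  0 , N / 8 , z<s , trans (m≡m%n+[m/n]*n N 8) (cong₂ _+_ N%8 (*-comm (N / 8) 8))
smallRoot N N%8 (suc j) 4SS≤N
  with u , m , u<D , N≡ ← smallRoot N N%8 j
         (≤-trans (*-mono-≤ (m≤n*m (2 ^ suc j) 2) (m≤n*m (2 ^ suc j) 2)) 4SS≤N)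
  with halve m
... | h , inj₁ refl =
  u , h , <-≤-trans u<D (m≤n*m (2 ^ j) 2) ,
  trans N≡ (cong ((1 + 2 * u) * (1 + 2 * u) +_) (swap (2 ^ suc j) h))
  where
  swap : ∀ S h → 4 * S * (2 * h) ≡ 4 * (2 * S) * h
  swap = solve-∀
... | h , inj₂ refl =
  let v , S≡ = m≤n⇒∃[o]m+o≡n (≤-trans u<D (m≤n*m (2 ^ j) 2))
      m′ , N≡′ = flipRoot (2 ^ j) {{m^n≢0 2 j}} u v h S≡ 4SS≤N N≡
  in v , m′ , subst (v <_) S≡ (s≤s (m≤n+m v u)) , N≡′

-- Representation of N ≡ 1 modulo 8

enclosing : ∀ N j → N < 2 ^ suc j * 2 ^ suc j →
  N < 4 ⊎ ∃[ i ] (2 ^ suc i * 2 ^ suc i ≤ N × N < 2 ^ suc (suc i) * 2 ^ suc (suc i))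
enclosing N zero    N< = inj₁ N<
enclosing N (suc j) N< with N <? 2 ^ suc j * 2 ^ suc j
... | yes N<′ = enclosing N j N<′
... | no  N≮  = inj₂ (j , ≮⇒≥ N≮ , N<)

n<2^n : ∀ n → n < 2 ^ n
n<2^n zero    = z<s
n<2^n (suc n) = begin-strict
  1 + n          ≤⟨ +-monoˡ-≤ n (m^n>0 2 n) ⟩
  2 ^ n + n      <⟨ +-monoʳ-< (2 ^ n) (n<2^n n) ⟩
  2 ^ n + 2 ^ n  ≡⟨ cong (2 ^ n +_) (+-identityʳ (2 ^ n)) ⟨
  2 ^ suc n      ∎
  where open ≤-Reasoning

n<4^[1+n] : ∀ n → n < 2 ^ suc n * 2 ^ suc n
n<4^[1+n] n = <-≤-trans (n<2^n n) $ ≤-trans (m≤n*m (2 ^ n) 2) $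
  m≤m*n (2 ^ suc n) (2 ^ suc n) {{m^n≢0 2 (suc n)}}

squarePlusPractical : ∀ N → 0 < N → N % 8 ≡ 1 → SquarePlusPractical N
squarePlusPractical N 0<N N%8 with enclosing N N (n<4^[1+n] N)
-- Below 4 the congruence leaves only `N = 1`, which is 0² + 1.
squarePlusPractical 1 _ _ | inj₁ _ = 0 , 1 , practical-2^ 0 , refl
squarePlusPractical (suc (suc (suc (suc _)))) _ _ | inj₁ (s≤s (s≤s (s≤s (s≤s ()))))
squarePlusPractical N _ N%8 | inj₂ (j , SS≤N , N<)
  with u , m , u<D , N≡ ← smallRoot N N%8 j SS≤N =
  1 + 2 * u , 2 ^ (3 + j) * m ,
  practical-2^* (suc j) (3 + j) m (m≤n+m (suc j) 3) 0<m (<⇒≤ m<S) ,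
  trans N≡ (cong₂ _+_ (cong ((1 + 2 * u) *_) (sym (*-identityʳ _)))
                      (cong (_* m) (4S≡ (2 ^ j))))
  where
  S = 2 ^ suc j
  x = 1 + 2 * u

  4S≡ : ∀ D → 4 * (2 * D) ≡ 2 * (2 * (2 * D))
  4S≡ = solve-∀

  -- If `m` were 0, then `N = x²`, whereas `x < S` and `S * S ≤ N`.
  0<m : 0 < m
  0<m = n≢0⇒n>0 λ { refl → <⇒≢ (<-≤-trans (*-mono-< (1+2u<2D u<D) (1+2u<2D u<D)) SS≤N)
    (sym (trans N≡ (trans (cong (x * x +_) (*-zeroʳ (4 * S))) (+-identityʳ (x * x))))) }

  4SS≡ : ∀ S → 2 * S * (2 * S) ≡ 4 * S * S
  4SS≡ = solve-∀

  m<S : m < S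
  m<S = *-cancelˡ-< (4 * S) m S $ begin-strict
    4 * S * m          ≤⟨ m≤n+m (4 * S * m) (x * x) ⟩
    x * x + 4 * S * m  ≡⟨ N≡ ⟨
    N                  <⟨ N< ⟩
    2 * S * (2 * S)    ≡⟨ 4SS≡ S ⟩
    4 * S * S          ∎
    where open ≤-Reasoning

-- Obstructions

obstructingModuli smallPowers : List ℕ
obstructingModuli = 3 ∷ 5 ∷ 7 ∷ 11 ∷ 13 ∷ 16 ∷ []
smallPowers = 1 ∷ 2 ∷ 4 ∷ 8 ∷ []

-- A finite check. It serves twice below: for `P` itself when `P` is at most 16, and for the
-- divisors that could add up to 16.
obstructed-or-smallPower : ∀ {d} → d < 17 → 0 < d →
  Any (_∣ d) obstructingModuli ⊎ d ∈ smallPowers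
obstructed-or-smallPower = from-yes (allUpTo? (λ d →
  (0 <? d) →-dec (any? (_∣? d) obstructingModuli ⊎-dec (_∈?_ _≟_ d smallPowers))) 17)

unobstructed⇒smallPower : ∀ {P} → Practical P → ¬ Any (_∣ P) obstructingModuli →
  P ∈ smallPowers
unobstructed⇒smallPower {P} (0<P , sums) free with P <? 17
... | yes P<17 with obstructed-or-smallPower P<17 0<P
...   | inj₁ obstructed = contradiction obstructed free
...   | inj₂ P∈         = P∈
unobstructed⇒smallPower {P} (0<P , sums) free | no P≮17
  with ds , uds , dds , 16≡ ← sums 16 z<s (<⇒≤ (≮⇒≥ P≮17)) =
  -- The bound 15 is 1 + 2 + 4 + 8.
  contradiction (subst (_≤ 15) (sym 16≡) (sum-mono-⊆ uds ds⊆)) (<⇒≱ (n<1+n 15))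
  where
  ds⊆ : ds ⊆ smallPowers
  ds⊆ d∈ds with 0<d , d∣P ← All.lookup dds d∈ds
    with obstructed-or-smallPower (s≤s (subst (_ ≤_) (sym 16≡) (∈⇒≤sum d∈ds))) 0<d
  ... | inj₁ obstructed = contradiction (Any.map (λ p∣d → ∣-trans p∣d d∣P) obstructed) free
  ... | inj₂ d∈         = d∈

-- Non-residues and periodicity

-- Says that `N - s` is not a square modulo `p`, written additively to avoid subtraction; `p` need
-- not be prime, and 16 occurs.
Nonresidue : ∀ p .{{_ : NonZero p}} → ℕ → ℕ → Set
Nonresidue p s N = ∀ (a : Fin p) → (toℕ a * toℕ a + s) % p ≢ N % p

nonresidue? : ∀ p .{{_ : NonZero p}} s N → Dec (Nonresidue p s N)
nonresidue? p s N = all? λ a → ¬? ((toℕ a * toℕ a + s) % p ≟ N % p)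

nonresidue⇒≢ : ∀ p .{{_ : NonZero p}} {s N} → Nonresidue p s N →
  ∀ x P → P % p ≡ s % p → N ≢ x ^ 2 + P
nonresidue⇒≢ p {s} {N} nr x P P≡s refl = nr (fromℕ< (m%n<n x p)) $ begin
  (a * a + s) % p                        ≡⟨ cong (λ b → (b * b + s) % p) (toℕ-fromℕ< (m%n<n x p)) ⟩
  (x % p * (x % p) + s) % p              ≡⟨ %-distribˡ-+ (x % p * (x % p)) s p ⟩
  ((x % p * (x % p)) % p + s % p) % p    ≡⟨ cong₂ (λ b c → (b + c) % p) (%-distribˡ-* x x p) P≡s ⟨
  ((x * x) % p + P % p) % p              ≡⟨ %-distribˡ-+ (x * x) P p ⟨
  (x * x + P) % p                        ≡⟨ cong (λ b → (x * b + P) % p) (*-identityʳ x) ⟨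
  (x ^ 2 + P) % p                        ∎
  where
  open ≡-Reasoning
  a = toℕ (fromℕ< (m%n<n x p))

-- The product 2·3·5·7·11·13. A shift of `k` by it moves `8 * k + j` by 240240, which all the moduli
-- divide, 16 included.
period : ℕ
period = 30030

-- The first six conditions exclude `P` divisible by an obstructing modulus, the last four exclude
-- `P` equal to 1, 2, 4, 8. Numbers that are 1 modulo 8 never qualify, being squares modulo 16.
Obstructed : ℕ → Set
Obstructed N =
  (Nonresidue 3 0 N × Nonresidue 5 0 N × Nonresidue 7 0 N × Nonresidue 11 0 N ×
   Nonresidue 13 0 N × Nonresidue 16 0 N) ×
  (Nonresidue 5 1 N × Nonresidue 11 2 N × Nonresidue 11 4 N × Nonresidue 11 8 N)

obstructed? : ∀ N → Dec (Obstructed N)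
obstructed? N =
  (nonresidue? 3 0 N ×-dec nonresidue? 5 0 N ×-dec nonresidue? 7 0 N ×-dec nonresidue? 11 0 N ×-dec
   nonresidue? 13 0 N ×-dec nonresidue? 16 0 N) ×-dec
  (nonresidue? 5 1 N ×-dec nonresidue? 11 2 N ×-dec nonresidue? 11 4 N ×-dec nonresidue? 11 8 N)

obstructed⇒¬squarePlusPractical : ∀ {N} → Obstructed N → ¬ SquarePlusPractical N
obstructed⇒¬squarePlusPractical
  {N} ((n3 , n5 , n7 , n11 , n13 , n16) , (n5-1 , n11-2 , n11-4 , n11-8)) (x , P , prac , N≡)
  = excluded (unobstructed⇒smallPower prac free)
  where
  residue0 : ∀ p .{{_ : NonZero p}} → Nonresidue p 0 N → ¬ p ∣ P
  residue0 p nr p∣P = nonresidue⇒≢ p nr x P (trans (n∣m⇒m%n≡0 P p p∣P) (sym (0%n p))) N≡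
    where
    0%n : ∀ n .{{_ : NonZero n}} → 0 % n ≡ 0
    0%n (suc _) = refl
  free : ¬ Any (_∣ P) obstructingModuli
  free (here d)                                 = residue0 3 n3 d
  free (there (here d))                         = residue0 5 n5 d
  free (there (there (here d)))                 = residue0 7 n7 d
  free (there (there (there (here d))))         = residue0 11 n11 d
  free (there (there (there (there (here d))))) = residue0 13 n13 d
  free (there (there (there (there (there (here d)))))) = residue0 16 n16 d
  excluded : ¬ P ∈ smallPowers
  excluded (here refl)                         = nonresidue⇒≢ 5 n5-1 x P refl N≡
  excluded (there (here refl))                 = nonresidue⇒≢ 11 n11-2 x P refl N≡
  excluded (there (there (here refl)))         = nonresidue⇒≢ 11 n11-4 x P refl N≡
  excluded (there (there (there (here refl)))) = nonresidue⇒≢ 11 n11-8 x P refl N≡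

obstructed-periodic : ∀ N t → Obstructed N → Obstructed (N + t * (8 * period))
obstructed-periodic N t ((n3 , n5 , n7 , n11 , n13 , n16) , (n5-1 , n11-2 , n11-4 , n11-8)) =
  ( shift-by 3 n3 , shift-by 5 n5 , shift-by 7 n7 , shift-by 11 n11
  , shift-by 13 n13 , shift-by 16 n16 ) ,
  ( shift-by 5 n5-1 , shift-by 11 n11-2 , shift-by 11 n11-4 , shift-by 11 n11-8 )
  where
  M = 8 * period
  shift-by : ∀ p .{{_ : NonZero p}} {p∣M : True (p ∣? M)} {s} →
             Nonresidue p s N → Nonresidue p s (N + t * M)
  shift-by p {p∣M} nr a eq = nr a (trans eq (%-remove-+ʳ N (∣n⇒∣m*n t (toWitness p∣M))))

infinitelyMany-obstructed : ∀ j k → Obstructed (8 * k + j) →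
  InfinitelyMany (λ k → ¬ SquarePlusPractical (8 * k + j))
infinitelyMany-obstructed j k obs b =
  k + b * period , ≤-trans (m≤m*n b period) (m≤n+m _ k) ,
  obstructed⇒¬squarePlusPractical
    (subst Obstructed (regroup k b period j) (obstructed-periodic (8 * k + j) b obs))
  where
  regroup : ∀ k b p j → 8 * k + j + b * (8 * p) ≡ 8 * (k + b * p) + j
  regroup = solve-∀

theorem3p3 : (∀ (N : ℕ) → 0 < N → N % 8 ≡ 1 → SquarePlusPractical N)
    × (∀ (j : ℕ) → j ∈ (0 ∷ 2 ∷ 3 ∷ 4 ∷ 5 ∷ 6 ∷ 7 ∷ []) →
    InfinitelyMany (λ k → ¬ SquarePlusPractical (8 * k + j)))
theorem3p3 = squarePlusPractical , λ
  -- Each `k` makes `8 * k + j` satisfy all ten conditions, as evaluating `obstructed?` confirms.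
  -- For `j` equal to 0 or 4 it is odd, because 0 and 4 are squares modulo 16.
  { _ (here refl)                                         → witness 0 1291
  ; _ (there (here refl))                                 → witness 2 3972
  ; _ (there (there (here refl)))                         → witness 3 280
  ; _ (there (there (there (here refl))))                 → witness 4 3023
  ; _ (there (there (there (there (here refl)))))         → witness 5 1146
  ; _ (there (there (there (there (there (here refl)))))) → witness 6 424
  ; _ (there (there (there (there (there (there (here refl))))))) → witness 7 692
  }
  where
  witness : ∀ j k {obs : True (obstructed? (8 * k + j))} →
    InfinitelyMany (λ k → ¬ SquarePlusPractical (8 * k + j))
  witness j k {obs} = infinitelyMany-obstructed j k (toWitness obs)
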